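{- There exists a Hoare-McCarthy algebra $\mathbb{A}^{st}$ (over the atom set $A$) such that for all closed terms $t,t'\in\mathcal{T}_{\Sigma^A_{ce}}$, $$\mathrm{CP}_{st}\vdash t=t'\iff \mathbb{A}^{st}\models t=t'.$$
   Context: Let $A$ be a non-empty, denumerable (finite or countably infinite) set of atoms. $\Sigma^A_{ce}$ is the one-sorted signature with sort $C$ (conditional expressions), constants $T$, $F$ and $a$ (one for each $a\in A$), and a ternary operation $x\triangleleft y\triangleright z$ ("if $y$ then $x$ else $z$"). $\mathcal{T}_{\Sigma^A_{ce}}$ is the set of closed (variable-free) terms over $\Sigma^A_{ce}$. $\mathrm{CP}$ is the set of the four equations (CP1) $x\triangleleft T\triangleright y=x$; (CP2) $x\triangleleft F\triangleright y=y$; (CP3) $T\triangleleft x\triangleright F=x$; (CP4) $x\triangleleft(y\triangleleft z\triangleright u)\triangleright v=(x\triangleleft y\triangleright v)\triangleleft z\triangleright(x\triangleleft u\triangleright v)$. $\mathrm{CP}_{st}$ (the axioms of static congruence, i.e. propositional logic) is $\mathrm{CP}$ together with the equations (CPstat) $(x\triangleleft y\triangleright z)\triangleleft u\triangleright v=(x\triangleleft u\triangleright v)\triangleleft y\triangleright(z\triangleleft u\triangleright v)$; (CPcontr) $(x\triangleleft y\triangleright z)\triangleleft y\triangleright u=x\triangleleft y\triangleright u$. $E\vdash t=t'$ means derivability in equational logic from the set $E$ of equations. A stateful proposition algebra (SPA) is a two-sorted algebra with sorts $C$ and $S$ (states), with the operations of $\Sigma^A_{ce}$ on sort $C$, a constant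 $c$ of sort $S$, and operations $\cdot\triangleleft\cdot\triangleright\cdot:S\times C\times S\to S$, $\bullet:C\times S\to S$ (apply), $!:C\times S\to C$ (reply), satisfying CP on sort $C$ and, for all $x,y,z$ in $C$ and $s,s'$ in $S$ ($\bullet$ and $!$ bind stronger than the conditional): (TS1) $s\triangleleft T\triangleright s'=s$; (TS2) $s\triangleleft F\triangleright s'=s'$; (TS3) if $x\neq T$ and $x\neq F$ then $s\triangleleft x\triangleright s'=c$; (SPA1) $T!s=T$; (SPA2) $F!s=F$; (SPA3) $(x\triangleleft y\triangleright z)!s=x!(y\bullet s)\triangleleft y!s\triangleright z!(y\bullet s)$; (SPA4) $T\bullet s=s$; (SPA5) $F\bullet s=s$; (SPA6) $(x\triangleleft y\triangleright z)\bullet s=x\bullet(y\bullet s)\triangleleft y!s\triangleright z\bullet(y\bullet s)$; (SPA7) $x!s=T$ or $x!s=F$; (SPA8) if $x!s=y!s$ and $x\bullet s=y\bullet s$ for all $s$ in $S$, then $x=y$. A Hoare-McCarthy algebra (HMA) is the $\Sigma^A_{ce}$-reduct of a stateful proposition algebra (i.e. sort $C$ with the operations of $\Sigma^A_{ce}$). -}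

module Defs where

open import Level using (Level; _⊔_) renaming (suc to lsuc)
open import Data.Empty using (⊥)
open import Data.Fin using (Fin)
open import Data.Nat using (ℕ)
open import Data.Product using (Σ-syntax; ∃-syntax; _×_)
open import Data.Sum using (_⊎_)
open import Function.Bundles using (_↔_)
open import Relation.Binary using (Rel; IsEquivalence)
open import Relation.Binary.PropositionalEquality using (_≡_)
open import Relation.Nullary using (¬_)

Denumerable : ∀ {a} → Set a → Set a
Denumerable A = (∃[ n ] (A ↔ Fin n)) ⊎ (A ↔ ℕ)

-- `x ◁ y ▷ z` reads "if y then x else z".
data Term {a} (A : Set a) (V : Set) : Set a where
  var    : V → Term A V
  T F    : Term A V
  atom   : A → Term A V
  _◁_▷_ : (x y z : Term A V) → Term A V

infix 5 _◁_▷_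

ClosedTerm OpenTerm : ∀ {a} → Set a → Set a
ClosedTerm A = Term A ⊥
OpenTerm   A = Term A ℕ

module _ {a} {A : Set a} where

  _[_] : ∀ {V W} → Term A V → (V → Term A W) → Term A W
  var v       [ σ ] = σ v
  T           [ σ ] = T
  F           [ σ ] = F
  atom b      [ σ ] = atom b
  (x ◁ y ▷ z) [ σ ] = (x [ σ ]) ◁ (y [ σ ]) ▷ (z [ σ ])

  ⌜_⌝ : ClosedTerm A → OpenTerm A
  ⌜ t ⌝ = t [ (λ ()) ]

infix 4 _≐_

record Equation {a} (A : Set a) : Set a where
  constructor _≐_
  field
    lhs rhs : OpenTerm A

Theory : ∀ {a} → Set a → Set (lsuc a)
Theory {a} A = Equation A → Set a

module _ {a} {A : Set a} where

  infix 3 _⊢_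

  data _⊢_ (E : Theory A) : Equation A → Set a where
    axiom : ∀ {e} → E e → E ⊢ e
    refl  : ∀ {t} → E ⊢ t ≐ t
    sym   : ∀ {t u} → E ⊢ t ≐ u → E ⊢ u ≐ t
    trans : ∀ {t u v} → E ⊢ t ≐ u → E ⊢ u ≐ v → E ⊢ t ≐ v
    cong  : ∀ {x x′ y y′ z z′} →
            E ⊢ x ≐ x′ → E ⊢ y ≐ y′ → E ⊢ z ≐ z′ →
            E ⊢ (x ◁ y ▷ z) ≐ (x′ ◁ y′ ▷ z′)
    subst : ∀ {t u} (σ : ℕ → OpenTerm A) →
            E ⊢ t ≐ u → E ⊢ (t [ σ ]) ≐ (u [ σ ])

module Axioms {a} (A : Set a) where

  private
    x y z u v : OpenTerm A
    x = var 0
    y = var 1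
    z = var 2
    u = var 3
    v = var 4

  data CP : Theory A where
    CP1 : CP ((x ◁ T ▷ y) ≐ x)
    CP2 : CP ((x ◁ F ▷ y) ≐ y)
    CP3 : CP ((T ◁ x ▷ F) ≐ x)
    CP4 : CP ((x ◁ (y ◁ z ▷ u) ▷ v) ≐ ((x ◁ y ▷ v) ◁ z ▷ (x ◁ u ▷ v)))

  data CPst : Theory A where
    fromCP  : ∀ {e} → CP e → CPst e
    CPstat  : CPst (((x ◁ y ▷ z) ◁ u ▷ v) ≐ ((x ◁ u ▷ v) ◁ y ▷ (z ◁ u ▷ v)))
    CPcontr : CPst (((x ◁ y ▷ z) ◁ y ▷ u) ≐ (x ◁ y ▷ u))

open Axioms public

-- Each sort of an algebra is a setoid, whose equivalence plays the role of
-- equality; quotient algebras are therefore available.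
record CEAlgebra {a} (A : Set a) (c ℓ : Level) : Set (a ⊔ lsuc (c ⊔ ℓ)) where
  infix 4 _≈_
  field
    Carrier       : Set c
    _≈_           : Rel Carrier ℓ
    isEquivalence : IsEquivalence _≈_
    true false    : Carrier
    atomᶜ         : A → Carrier
    cond          : (x y z : Carrier) → Carrier
    cond-cong     : ∀ {x x′ y y′ z z′} → x ≈ x′ → y ≈ y′ → z ≈ z′ →
                    cond x y z ≈ cond x′ y′ z′

  ⟦_⟧ : ∀ {V} → Term A V → (V → Carrier) → Carrier
  ⟦ var v ⟧     ρ = ρ v
  ⟦ T ⟧         ρ = true
  ⟦ F ⟧         ρ = false
  ⟦ atom b ⟧    ρ = atomᶜ b
  ⟦ x ◁ y ▷ z ⟧ ρ = cond (⟦ x ⟧ ρ) (⟦ y ⟧ ρ) (⟦ z ⟧ ρ)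

infix 3 _⊨_

_⊨_ : ∀ {a c ℓ} {A : Set a} → CEAlgebra A c ℓ → Equation A → Set (c ⊔ ℓ)
𝔸 ⊨ (t ≐ u) = ∀ ρ → ⟦ t ⟧ ρ ≈ ⟦ u ⟧ ρ
  where open CEAlgebra 𝔸

record SPA {a} (A : Set a) (c ℓ s m : Level) : Set (a ⊔ lsuc (c ⊔ ℓ ⊔ s ⊔ m)) where
  infix  4 _≈ˢ_
  infixr 8 _!_ _•_
  field
    reduct : CEAlgebra A c ℓ

  open CEAlgebra reduct public renaming (Carrier to C)

  field
    S              : Set s
    _≈ˢ_           : Rel S m
    isEquivalenceˢ : IsEquivalence _≈ˢ_
    c₀             : S
    condˢ          : S → C → S → S
    _•_            : C → S → S
    _!_            : C → S → C

    condˢ-cong     : ∀ {p p′ x x′ q q′} → p ≈ˢ p′ → x ≈ x′ → q ≈ˢ q′ →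
                     condˢ p x q ≈ˢ condˢ p′ x′ q′
    •-cong         : ∀ {x x′ p p′} → x ≈ x′ → p ≈ˢ p′ → x • p ≈ˢ x′ • p′
    !-cong         : ∀ {x x′ p p′} → x ≈ x′ → p ≈ˢ p′ → x ! p ≈ x′ ! p′

    ⊨CP  : ∀ {e} → CP A e → reduct ⊨ e

    TS1  : ∀ p q → condˢ p true q ≈ˢ p
    TS2  : ∀ p q → condˢ p false q ≈ˢ q
    TS3  : ∀ p x q → ¬ (x ≈ true) → ¬ (x ≈ false) → condˢ p x q ≈ˢ c₀
    SPA1 : ∀ p → true ! p ≈ true
    SPA2 : ∀ p → false ! p ≈ false
    SPA3 : ∀ x y z p → cond x y z ! p ≈ cond (x ! (y • p)) (y ! p) (z ! (y • p))
    SPA4 : ∀ p → true • p ≈ˢ p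
    SPA5 : ∀ p → false • p ≈ˢ p
    SPA6 : ∀ x y z p → cond x y z • p ≈ˢ condˢ (x • (y • p)) (y ! p) (z • (y • p))
    SPA7 : ∀ x p → (x ! p ≈ true) ⊎ (x ! p ≈ false)
    SPA8 : ∀ x y → (∀ p → (x ! p ≈ y ! p) × (x • p ≈ˢ y • p)) → x ≈ y

IsHMA : ∀ {a c ℓ} {A : Set a} (s m : Level) → CEAlgebra A c ℓ →
        Set (a ⊔ lsuc (c ⊔ ℓ ⊔ s ⊔ m))
IsHMA {c = c} {ℓ} {A} s m 𝔸 = Σ[ P ∈ SPA A c ℓ s m ] SPA.reduct P ≡ 𝔸

{-# OPTIONS --safe #-}
module Submission where

open import Defs
open import Data.Bool using (Bool; true; false; if_then_else_)
import Data.Bool.Properties as Bool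
import Data.Fin.Properties as Fin
open import Data.List using (List; []; _∷_; _++_)
open import Data.List.Membership.Propositional.Properties using (∈-++⁻)
open import Data.List.Relation.Binary.Subset.Propositional using (_⊆_)
open import Data.List.Relation.Binary.Subset.Propositional.Properties
  using (xs⊆xs++ys; xs⊆ys++xs)
open import Data.List.Relation.Unary.Any using (here; there)
open import Data.Nat using (ℕ)
import Data.Nat.Properties as ℕ
open import Data.Product using (Σ-syntax; ∃-syntax; _×_; _,_; proj₁)
open import Data.Sum using (_⊎_; inj₁; inj₂)
open import Function.Bundles using (_⇔_; mk⇔; module Equivalence)
open import Function.Properties.Inverse using (↔⇒↣)
open import Relation.Binary using (Setoid; IsEquivalence; DecidableEquality)
open import Relation.Binary.PropositionalEquality as ≡ using (_≡_; _≢_; refl)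
import Relation.Binary.Reasoning.Setoid as SetoidReasoning
open import Relation.Nullary using (¬_; Dec; yes; no; contradiction)
open import Relation.Nullary.Decidable using (via-injection)

-- Closed terms denote Boolean functions of the atoms; the states are the
-- valuations of the atoms, and evaluating a term never changes the state.
-- Completeness rests on the Shannon expansion t = t[a≔T] ◁ a ▷ t[a≔F], which is
-- derivable in CPst: eliminating the atoms of two terms one at a time yields
-- either a derivation of their equality or a valuation separating them.  The
-- same dichotomy decides whether a term equals T or F, as TS3 requires.

denumerable⇒≟ : ∀ {a} {A : Set a} → Denumerable A → DecidableEquality A
denumerable⇒≟ (inj₁ (_ , A↔Fin)) = via-injection (↔⇒↣ A↔Fin) Fin._≟_
denumerable⇒≟ (inj₂ A↔ℕ)         = via-injection (↔⇒↣ A↔ℕ) ℕ._≟_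

-- Soundness of equational logic

module _ {a c ℓ} {A : Set a} (𝔸 : CEAlgebra A c ℓ) where
  open CEAlgebra 𝔸
  private module ≈ = IsEquivalence isEquivalence

  ⟦⟧-[] : ∀ {V W} (t : Term A V) (σ : V → Term A W) ρ →
          ⟦ t [ σ ] ⟧ ρ ≡ ⟦ t ⟧ (λ v → ⟦ σ v ⟧ ρ)
  ⟦⟧-[] (var v)     σ ρ = refl
  ⟦⟧-[] T           σ ρ = refl
  ⟦⟧-[] F           σ ρ = refl
  ⟦⟧-[] (atom b)    σ ρ = refl
  ⟦⟧-[] (x ◁ y ▷ z) σ ρ
    rewrite ⟦⟧-[] x σ ρ | ⟦⟧-[] y σ ρ | ⟦⟧-[] z σ ρ = refl

  soundness : ∀ {E : Theory A} → (∀ {e} → E e → 𝔸 ⊨ e) → ∀ {e} → E ⊢ e → 𝔸 ⊨ e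
  soundness ⊨E (axiom e)                ρ = ⊨E e ρ
  soundness ⊨E refl                     ρ = ≈.refl
  soundness ⊨E (sym d)                  ρ = ≈.sym (soundness ⊨E d ρ)
  soundness ⊨E (trans d e)              ρ = ≈.trans (soundness ⊨E d ρ) (soundness ⊨E e ρ)
  soundness ⊨E (cong d e f)             ρ =
    cond-cong (soundness ⊨E d ρ) (soundness ⊨E e ρ) (soundness ⊨E f ρ)
  soundness ⊨E (subst {t} {u} σ d)      ρ
    rewrite ⟦⟧-[] t σ ρ | ⟦⟧-[] u σ ρ = soundness ⊨E d _

-- Derived laws of static congruence

module Derivations {a} (A : Set a) where

  ⊢-setoid : Setoid a a
  ⊢-setoid = record
    { Carrier       = OpenTerm A
    ; _≈_           = λ t u → CPst A ⊢ t ≐ u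
    ; isEquivalence = record { refl = refl ; sym = sym ; trans = trans }
    }

  open SetoidReasoning ⊢-setoid

  private
    assign : (x y z u v : OpenTerm A) → ℕ → OpenTerm A
    assign x y z u v 0 = x
    assign x y z u v 1 = y
    assign x y z u v 2 = z
    assign x y z u v 3 = u
    assign x y z u v _ = v

    variable
      x y z u v x′ z′ : OpenTerm A

  cp1 : CPst A ⊢ (x ◁ T ▷ y) ≐ x
  cp1 {x} {y} = subst (assign x y T T T) (axiom (fromCP CP1))

  cp2 : CPst A ⊢ (x ◁ F ▷ y) ≐ y
  cp2 {x} {y} = subst (assign x y T T T) (axiom (fromCP CP2))

  cp3 : CPst A ⊢ (T ◁ x ▷ F) ≐ x
  cp3 {x} = subst (assign x T T T T) (axiom (fromCP CP3))

  cp4 : CPst A ⊢ (x ◁ (y ◁ z ▷ u) ▷ v) ≐ ((x ◁ y ▷ v) ◁ z ▷ (x ◁ u ▷ v))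
  cp4 {x} {y} {z} {u} {v} = subst (assign x y z u v) (axiom (fromCP CP4))

  stat : CPst A ⊢ ((x ◁ y ▷ z) ◁ u ▷ v) ≐ ((x ◁ u ▷ v) ◁ y ▷ (z ◁ u ▷ v))
  stat {x} {y} {z} {u} {v} = subst (assign x y z u v) (axiom CPstat)

  contr : CPst A ⊢ ((x ◁ y ▷ z) ◁ y ▷ u) ≐ (x ◁ y ▷ u)
  contr {x} {y} {z} {u} = subst (assign x y z u T) (axiom CPcontr)

  -- CPstat with u = F.
  idem : CPst A ⊢ (x ◁ y ▷ x) ≐ x
  idem {x} {y} = begin
    x ◁ y ▷ x                          ≈⟨ cong cp2 refl cp2 ⟨
    (T ◁ F ▷ x) ◁ y ▷ (T ◁ F ▷ x)      ≈⟨ stat ⟨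
    (T ◁ y ▷ T) ◁ F ▷ x                ≈⟨ cp2 ⟩
    x                                  ∎

  -- `F ◁ y ▷ T` is the negation of `y`: CP4 splits on it, and CP2 and CP1 pick the branches. Laws
  -- about the left branch thereby transfer to the right one.
  swap : CPst A ⊢ (x ◁ y ▷ z) ≐ (z ◁ (F ◁ y ▷ T) ▷ x)
  swap = sym (trans cp4 (cong cp2 refl cp1))

  statʳ : CPst A ⊢ (x ◁ y ▷ (z ◁ u ▷ v)) ≐ ((x ◁ y ▷ z) ◁ u ▷ (x ◁ y ▷ v))
  statʳ = trans swap (trans stat (cong (sym swap) refl (sym swap)))

  contrʳ : CPst A ⊢ (x ◁ y ▷ (z ◁ y ▷ u)) ≐ (x ◁ y ▷ u)
  contrʳ {x} {y} {z} {u} = begin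
    x ◁ y ▷ (z ◁ y ▷ u)                            ≈⟨ swap ⟩
    -- The inner conditional must be swapped too, so that both levels test the same condition and
    -- `contr` applies.
    (z ◁ y ▷ u) ◁ (F ◁ y ▷ T) ▷ x                  ≈⟨ cong swap refl refl ⟩
    (u ◁ (F ◁ y ▷ T) ▷ z) ◁ (F ◁ y ▷ T) ▷ x        ≈⟨ contr ⟩
    u ◁ (F ◁ y ▷ T) ▷ x                            ≈⟨ swap ⟨
    x ◁ y ▷ u                                      ∎

  contr₂ : CPst A ⊢ ((x ◁ y ▷ z) ◁ y ▷ (u ◁ y ▷ v)) ≐ (x ◁ y ▷ v)
  contr₂ = trans contr contrʳ

  -- `stat` pulls the test of `u` out of the left branch and `statʳ` out of the right one; `contr₂`
  -- then drops the repeated test of `u`.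
  interchange : CPst A ⊢ ((x ◁ u ▷ x′) ◁ y ▷ (z ◁ u ▷ z′)) ≐
                         ((x ◁ y ▷ z) ◁ u ▷ (x′ ◁ y ▷ z′))
  interchange = trans stat (trans (cong statʳ refl statʳ) contr₂)

  -- The inductive step of the Shannon expansion. CP4 brings the test of `u` inside the condition to
  -- the front, `interchange` does so for the branches, and `contr₂` merges the nested tests.
  cond-expansion : ∀ {x₁ x₀ y₁ y₀ z₁ z₀} →
    CPst A ⊢ x ≐ (x₁ ◁ u ▷ x₀) → CPst A ⊢ y ≐ (y₁ ◁ u ▷ y₀) →
    CPst A ⊢ z ≐ (z₁ ◁ u ▷ z₀) →
    CPst A ⊢ (x ◁ y ▷ z) ≐ ((x₁ ◁ y₁ ▷ z₁) ◁ u ▷ (x₀ ◁ y₀ ▷ z₀))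
  cond-expansion dx dy dz =
    trans (cong dx dy dz)
      (trans cp4 (trans (cong interchange refl interchange) contr₂))

-- Boolean semantics and the static algebra

module Valuations {a} (A : Set a) where

  Valuation : Set a
  Valuation = A → Bool

  lit : ∀ {V} → Bool → Term A V
  lit true  = T
  lit false = F

  eval : Valuation → ClosedTerm A → Bool
  eval f T           = true
  eval f F           = false
  eval f (atom b)    = f b
  eval f (x ◁ y ▷ z) = if eval f y then eval f x else eval f z

  infix 4 _≋_

  _≋_ : ClosedTerm A → ClosedTerm A → Set a
  x ≋ y = ∀ f → eval f x ≡ eval f y

  eval-lit : ∀ f b → eval f (lit b) ≡ b
  eval-lit f true  = refl
  eval-lit f false = refl

  -- Lets states be compared pointwise: replies then respect equality of states without function
  -- extensionality.
  eval-cong : ∀ {f g} → (∀ b → f b ≡ g b) → ∀ t → eval f t ≡ eval g t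
  eval-cong f≗g T           = refl
  eval-cong f≗g F           = refl
  eval-cong f≗g (atom b)    = f≗g b
  eval-cong f≗g (x ◁ y ▷ z)
    rewrite eval-cong f≗g x | eval-cong f≗g y | eval-cong f≗g z = refl

  -- The carrier consists of terms up to `_≋_` instead of Boolean functions, so that equality with
  -- `T` and `F` can be decided by eliminating the finitely many atoms of a term.
  static : CEAlgebra A a a
  static = record
    { Carrier       = ClosedTerm A
    ; _≈_           = _≋_
    ; isEquivalence = record
      { refl  = λ _ → refl
      ; sym   = λ x≋y f → ≡.sym (x≋y f)
      ; trans = λ x≋y y≋z f → ≡.trans (x≋y f) (y≋z f)
      }
    ; true      = T
    ; false     = F
    ; atomᶜ     = atom
    ; cond      = _◁_▷_
    ; cond-cong = λ {x} {x′} {y} {y′} {z} {z′} → cond-cong {x} {x′} {y} {y′} {z} {z′}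
    }
    where
    cond-cong : ∀ {x x′ y y′ z z′} → x ≋ x′ → y ≋ y′ → z ≋ z′ →
                (x ◁ y ▷ z) ≋ (x′ ◁ y′ ▷ z′)
    cond-cong p q r f rewrite p f | q f | r f = refl

  open CEAlgebra static using (⟦_⟧)

  ⟦⌜⌝⟧ : ∀ t ρ → ⟦ ⌜ t ⌝ ⟧ ρ ≡ t
  ⟦⌜⌝⟧ T           ρ = refl
  ⟦⌜⌝⟧ F           ρ = refl
  ⟦⌜⌝⟧ (atom b)    ρ = refl
  ⟦⌜⌝⟧ (x ◁ y ▷ z) ρ =
    ≡.cong₂ (λ x (y , z) → x ◁ y ▷ z) (⟦⌜⌝⟧ x ρ) (≡.cong₂ _,_ (⟦⌜⌝⟧ y ρ) (⟦⌜⌝⟧ z ρ))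

  ⊨⇔≋ : ∀ t t′ → (static ⊨ ⌜ t ⌝ ≐ ⌜ t′ ⌝) ⇔ (t ≋ t′)
  ⊨⇔≋ t t′ = mk⇔
    -- Closed terms ignore the assignment, so the constant `T` serves as an arbitrary one.
    (λ m → ≡.subst₂ _≋_ (⟦⌜⌝⟧ t _) (⟦⌜⌝⟧ t′ _) (m (λ _ → T)))
    (λ t≋t′ ρ → ≡.subst₂ _≋_ (≡.sym (⟦⌜⌝⟧ t ρ)) (≡.sym (⟦⌜⌝⟧ t′ ρ)) t≋t′)

  static⊨CP : ∀ {e} → CP A e → static ⊨ e
  static⊨CP CP1 ρ f = refl
  static⊨CP CP2 ρ f = refl
  static⊨CP CP3 ρ f with eval f (ρ 0)
  ... | true  = refl
  ... | false = refl
  static⊨CP CP4 ρ f with eval f (ρ 2)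
  ... | true  = refl
  ... | false = refl

  static⊨CPst : ∀ {e} → CPst A e → static ⊨ e
  static⊨CPst (fromCP e) = static⊨CP e
  static⊨CPst CPstat ρ f with eval f (ρ 1) | eval f (ρ 3)
  ... | true  | true  = refl
  ... | true  | false = refl
  ... | false | true  = refl
  ... | false | false = refl
  static⊨CPst CPcontr ρ f with eval f (ρ 1)
  ... | true  = refl
  ... | false = refl

  ⊢⇒≋ : ∀ t t′ → CPst A ⊢ ⌜ t ⌝ ≐ ⌜ t′ ⌝ → t ≋ t′
  ⊢⇒≋ t t′ d = Equivalence.to (⊨⇔≋ t t′) (soundness static static⊨CPst d)

-- Completeness by elimination of atoms

module Completeness {a} (A : Set a) (_≟_ : DecidableEquality A) where

  open Derivations A
  open Valuations A

  atoms : ClosedTerm A → List A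
  atoms T           = []
  atoms F           = []
  atoms (atom b)    = b ∷ []
  atoms (x ◁ y ▷ z) = atoms x ++ atoms y ++ atoms z

  module _ {x y z : ClosedTerm A} {L : List A} (s : atoms (x ◁ y ▷ z) ⊆ L) where

    atoms-x⊆ : atoms x ⊆ L
    atoms-x⊆ p = s (xs⊆xs++ys _ _ p)

    atoms-y⊆ : atoms y ⊆ L
    atoms-y⊆ p = s (xs⊆ys++xs _ (atoms x) (xs⊆xs++ys _ _ p))

    atoms-z⊆ : atoms z ⊆ L
    atoms-z⊆ p = s (xs⊆ys++xs _ (atoms x) (xs⊆ys++xs _ (atoms y) p))

  restrict : A → Bool → ClosedTerm A → ClosedTerm A
  restrict b v T           = T
  restrict b v F           = F
  restrict b v (atom c) with c ≟ b
  ... | yes _ = lit v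
  ... | no  _ = atom c
  restrict b v (x ◁ y ▷ z) = restrict b v x ◁ restrict b v y ▷ restrict b v z

  update : A → Bool → Valuation → Valuation
  update b v f c with c ≟ b
  ... | yes _ = v
  ... | no  _ = f c

  eval-restrict : ∀ b v f t → eval f (restrict b v t) ≡ eval (update b v f) t
  eval-restrict b v f T        = refl
  eval-restrict b v f F        = refl
  eval-restrict b v f (atom c) with c ≟ b
  ... | yes _ = eval-lit f v
  ... | no  _ = refl
  eval-restrict b v f (x ◁ y ▷ z)
    rewrite eval-restrict b v f x | eval-restrict b v f y | eval-restrict b v f z
    = refl

  -- Makes `L` a bound on the remaining atoms that shrinks with each restriction, which justifies
  -- the recursion in `derivable⊎separated`.
  atoms-restrict : ∀ b v {L} t → atoms t ⊆ b ∷ L → atoms (restrict b v t) ⊆ L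
  atoms-restrict b v     (atom c) s p with c ≟ b
  -- The truth value is split so that `lit` computes to a constant, which has no atoms.
  atoms-restrict b true  (atom c) s () | yes _
  atoms-restrict b false (atom c) s () | yes _
  atoms-restrict b v     (atom c) s p  | no c≢b with p | s (here refl)
  ... | here refl | here c≡b  = contradiction c≡b c≢b
  ... | here refl | there c∈L = c∈L
  atoms-restrict b v (x ◁ y ▷ z) s =
    ++-⊆ (atoms-restrict b v x (atoms-x⊆ {x} {y} {z} s))
      (++-⊆ (atoms-restrict b v y (atoms-y⊆ {x} {y} {z} s))
            (atoms-restrict b v z (atoms-z⊆ {x} {y} {z} s)))
    where
    ++-⊆ : ∀ {xs ys zs : List A} → xs ⊆ zs → ys ⊆ zs → xs ++ ys ⊆ zs
    ++-⊆ {xs} p q m with ∈-++⁻ xs m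
    ... | inj₁ i = p i
    ... | inj₂ j = q j

  -- At the atom `b` itself this is CP3; at every other leaf both branches coincide and `idem`
  -- applies.
  shannon : ∀ b t →
    CPst A ⊢ ⌜ t ⌝ ≐ (⌜ restrict b true t ⌝ ◁ atom b ▷ ⌜ restrict b false t ⌝)
  shannon b T        = sym idem
  shannon b F        = sym idem
  shannon b (atom c) with c ≟ b
  ... | yes refl = sym cp3
  ... | no  _    = sym idem
  shannon b (x ◁ y ▷ z) = cond-expansion (shannon b x) (shannon b y) (shannon b z)

  -- Without atoms, every condition reduces to `T` or `F`, and CP1 or CP2 selects the branch. The
  -- valuation `f` is arbitrary.
  ground : ∀ f t → atoms t ⊆ [] → CPst A ⊢ ⌜ t ⌝ ≐ lit (eval f t)
  ground f T        s = refl
  ground f F        s = refl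
  ground f (atom b) s with () ← s (here refl)
  ground f (x ◁ y ▷ z) s =
    trans (cong (ground f x (atoms-x⊆ {x} {y} {z} s))
                (ground f y (atoms-y⊆ {x} {y} {z} s))
                (ground f z (atoms-z⊆ {x} {y} {z} s)))
          (select (eval f y))
    where
    select : ∀ {b c} d →
      CPst A ⊢ (lit b ◁ lit d ▷ lit c) ≐ lit (if d then b else c)
    select true  = cp1
    select false = cp2

  Separated : ClosedTerm A → ClosedTerm A → Set a
  Separated t t′ = ∃[ f ] eval f t ≢ eval f t′

  -- Restricting a term amounts to updating the valuation, so a separating `f` lifts once it is
  -- overridden at `b`.
  separated-restrict : ∀ b v t t′ →
    Separated (restrict b v t) (restrict b v t′) → Separated t t′
  separated-restrict b v t t′ (f , f≢) = update b v f , λ eq →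
    f≢ (≡.trans (eval-restrict b v f t) (≡.trans eq (≡.sym (eval-restrict b v f t′))))

  derivable⊎separated : ∀ L t t′ → atoms t ⊆ L → atoms t′ ⊆ L →
    (CPst A ⊢ ⌜ t ⌝ ≐ ⌜ t′ ⌝) ⊎ Separated t t′
  derivable⊎separated [] t t′ s s′
    -- With no atoms left any valuation will do; the constant one is chosen.
    with f ← (λ _ → false) | eval f t Bool.≟ eval f t′
  ... | no  f≢ = inj₂ (f , f≢)
  ... | yes eq = inj₁ (trans (ground f t s)
    (≡.subst (λ b → CPst A ⊢ lit b ≐ ⌜ t′ ⌝) (≡.sym eq) (sym (ground f t′ s′))))
  derivable⊎separated (b ∷ L) t t′ s s′ with restricted true | restricted false
    where
    restricted : ∀ v → _
    restricted v = derivable⊎separated L (restrict b v t) (restrict b v t′)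
      (atoms-restrict b v t s) (atoms-restrict b v t′ s′)
  ... | inj₂ sep | _        = inj₂ (separated-restrict b true t t′ sep)
  ... | inj₁ _   | inj₂ sep = inj₂ (separated-restrict b false t t′ sep)
  ... | inj₁ d   | inj₁ e   =
    -- The two Shannon expansions agree branch by branch.
    inj₁ (trans (shannon b t) (trans (cong d refl e) (sym (shannon b t′))))

  derivable? : ∀ t t′ → (CPst A ⊢ ⌜ t ⌝ ≐ ⌜ t′ ⌝) ⊎ Separated t t′
  derivable? t t′ = derivable⊎separated (atoms t ++ atoms t′) t t′
    (xs⊆xs++ys _ _) (xs⊆ys++xs _ (atoms t))

  ≋⇒⊢ : ∀ t t′ → t ≋ t′ → CPst A ⊢ ⌜ t ⌝ ≐ ⌜ t′ ⌝
  ≋⇒⊢ t t′ t≋t′ with derivable? t t′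
  ... | inj₁ d        = d
  ... | inj₂ (f , f≢) = contradiction (t≋t′ f) f≢

  -- Although `_≋_` quantifies over all valuations, it is decided through derivability: soundness
  -- turns a derivation into an equivalence.
  _≋?_ : ∀ t t′ → Dec (t ≋ t′)
  t ≋? t′ with derivable? t t′
  ... | inj₁ d        = yes (⊢⇒≋ t t′ d)
  ... | inj₂ (f , f≢) = no λ t≋t′ → f≢ (t≋t′ f)

-- The stateful proposition algebra of valuations

module StaticSPA {a} (A : Set a) (_≟_ : DecidableEquality A) where

  open Valuations A
  open Completeness A _≟_ using (_≋?_)

  reply : ClosedTerm A → Valuation → ClosedTerm A
  reply x p = lit (eval p x)

  -- The cases are those of TS1, TS2 and TS3, distinguished up to `_≋_` and not by syntax, so that
  -- the operation respects equality of conditions.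
  condˢ : Valuation → ClosedTerm A → Valuation → Valuation
  condˢ p x q with x ≋? T | x ≋? F
  ... | yes _ | _     = p
  ... | no  _ | yes _ = q
  ... | no  _ | no  _ = λ _ → false

  condˢ-true : ∀ p {x} q → x ≋ T → condˢ p x q ≡ p
  condˢ-true p {x} q x≋T with x ≋? T | x ≋? F
  ... | yes _  | _ = refl
  ... | no x≢T | _ = contradiction x≋T x≢T

  condˢ-false : ∀ p {x} q → x ≋ F → condˢ p x q ≡ q
  condˢ-false p {x} q x≋F with x ≋? T | x ≋? F
  -- `T` and `F` differ under every valuation; the constant one refutes this case.
  ... | yes x≋T | _       with () ← ≡.trans (≡.sym (x≋T (λ _ → false))) (x≋F _)
  ... | no  _   | yes _   = refl
  ... | no  _   | no x≢F  = contradiction x≋F x≢F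

  condˢ-other : ∀ p x q → ¬ x ≋ T → ¬ x ≋ F → condˢ p x q ≡ λ _ → false
  condˢ-other p x q x≢T x≢F with x ≋? T | x ≋? F
  ... | yes x≋T | _       = contradiction x≋T x≢T
  ... | no  _   | yes x≋F = contradiction x≋F x≢F
  ... | no  _   | no  _   = refl

  condˢ-cong : ∀ {p p′ x x′ q q′} → (∀ b → p b ≡ p′ b) → x ≋ x′ →
               (∀ b → q b ≡ q′ b) → ∀ b → condˢ p x q b ≡ condˢ p′ x′ q′ b
  condˢ-cong {p′ = p′} {x} {x′} {q′ = q′} p≗ x≋x′ q≗ b with x ≋? T | x ≋? F
  ... | yes x≋T | _
    rewrite condˢ-true p′ {x′} q′ (λ f → ≡.trans (≡.sym (x≋x′ f)) (x≋T f)) = p≗ b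
  ... | no _    | yes x≋F
    rewrite condˢ-false p′ {x′} q′ (λ f → ≡.trans (≡.sym (x≋x′ f)) (x≋F f)) = q≗ b
  ... | no x≢T  | no x≢F
    rewrite condˢ-other p′ x′ q′ (λ e → x≢T λ f → ≡.trans (x≋x′ f) (e f))
                                 (λ e → x≢F λ f → ≡.trans (x≋x′ f) (e f)) = refl

  -- The content of SPA6: evaluation leaves the state alone, so both branches are `p`, and a reply
  -- is a literal, so the default state of TS3 never arises.
  condˢ-lit : ∀ p v b → condˢ p (lit v) p b ≡ p b
  condˢ-lit p true  b = ≡.cong-app (condˢ-true p {T} p λ _ → refl) b
  condˢ-lit p false b = ≡.cong-app (condˢ-false p {F} p λ _ → refl) b

  staticSPA : SPA A a a a a
  staticSPA = record
    { reduct         = static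
    ; S              = Valuation
    ; _≈ˢ_           = λ p q → ∀ b → p b ≡ q b
    ; isEquivalenceˢ = record
      { refl  = λ _ → refl
      ; sym   = λ p≗q b → ≡.sym (p≗q b)
      ; trans = λ p≗q q≗r b → ≡.trans (p≗q b) (q≗r b)
      }
    ; c₀         = λ _ → false
    ; condˢ      = condˢ
    ; _•_        = λ _ p → p
    ; _!_        = reply
    ; condˢ-cong = λ {p} {p′} {x} {x′} → condˢ-cong {p} {p′} {x} {x′}
    ; •-cong     = λ _ p≗q → p≗q
    ; !-cong     = λ {x} {x′} {p} {p′} x≋x′ p≗p′ f →
        ≡.cong (λ v → eval f (lit v)) (≡.trans (x≋x′ p) (eval-cong p≗p′ x′))
    ; ⊨CP        = static⊨CP
    ; TS1        = λ p q → ≡.cong-app (condˢ-true p {T} q λ _ → refl)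
    ; TS2        = λ p q → ≡.cong-app (condˢ-false p {F} q λ _ → refl)
    ; TS3        = λ p x q x≢T x≢F → ≡.cong-app (condˢ-other p x q x≢T x≢F)
    ; SPA1       = λ _ _ → refl
    ; SPA2       = λ _ _ → refl
    ; SPA3       = spa3
    ; SPA4       = λ _ _ → refl
    ; SPA5       = λ _ _ → refl
    ; SPA6       = λ x y z p b → ≡.sym (condˢ-lit p (eval p y) b)
    ; SPA7       = spa7
    -- The valuation `f` is itself taken as the state: the reply of `x` there is the literal of
    -- `eval f x`, so equal replies give equal values.
    ; SPA8       = λ x y same f →
        ≡.trans (≡.sym (eval-lit f _)) (≡.trans (proj₁ (same f) f) (eval-lit f _))
    }
    where
    spa3 : ∀ x y z p → reply (x ◁ y ▷ z) p ≋ (reply x p ◁ reply y p ▷ reply z p)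
    spa3 x y z p f with eval p y
    ... | true  = refl
    ... | false = refl

    spa7 : ∀ x p → (reply x p ≋ T) ⊎ (reply x p ≋ F)
    spa7 x p with eval p x
    ... | true  = inj₁ λ _ → refl
    ... | false = inj₂ λ _ → refl

theorem8 : ∀ {a} (A : Set a) → A → Denumerable A →
    Σ[ 𝔸 ∈ CEAlgebra A a a ] IsHMA a a 𝔸 ×
    ((t t′ : ClosedTerm A) →
    (CPst A ⊢ ⌜ t ⌝ ≐ ⌜ t′ ⌝) ⇔ (𝔸 ⊨ ⌜ t ⌝ ≐ ⌜ t′ ⌝))
theorem8 A _ den = static , (staticSPA , refl) , λ t t′ → mk⇔
    (soundness static static⊨CPst)
    (λ m → ≋⇒⊢ t t′ (Equivalence.to (⊨⇔≋ t t′) m))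
  where
  open Valuations A
  open Completeness A (denumerable⇒≟ den)
  open StaticSPA A (denumerable⇒≟ den)
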